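{- Let $u$ be any configuration on $K_{m,n}$. Consider the following procedure. Set $v_0=\mathrm{park}(u)$, $f_0=0$ and $k=0$. While the value of $v_k$ at the sink $a_m$ is $\ge 0$: choose an index $i$ with $(v_k)_{b_i}=0$ (such an index always exists), set $v_{k+1}=\mathrm{park}(v_k-e_{b_i})$, $f_{k+1}=f_k+e_{b_i}$, and increase $k$ by one. Then this procedure is always executable and terminates after some finite number $N$ of iterations, and for any choice of the indices $i$ along the way, the final configuration $f_N$ is a proof for the rank of $u$; in particular $\mathrm{rank}(u)=N-1=\mathrm{degree}(f_N)-1$.
   Context: Let $m,n\ge 1$. $K_{m,n}$ is the complete bipartite graph with vertex set $V=A_m\sqcup B_n$, $A_m=\{a_1,\dots,a_m\}$, $B_n=\{b_1,\dots,b_n\}$, with exactly one edge $\{a_i,b_j\}$ for every $i,j$ and no other edges; the vertex $a_m$ is called the sink. A configuration is a function $u:V\to\mathbb Z$, written $u_c=u(c)$; $\mathrm{degree}(u)=\sum_{c\in V}u_c$. For $c\in V$, $e_c$ is the configuration equal to $1$ at $c$ and $0$ elsewhere. For $c\in V$ with graph degree $d_c$ (so $d_{a_i}=n$, $d_{b_j}=m$), the toppling vector is $\Delta^{(c)}=d_c e_c-\sum_{c'\text{ adjacent to }c}e_{c'}$, and for $C\subseteq V$, $\Delta^{(C)}=\sum_{c\in C}\Delta^{(c)}$. Two configurations are toppling equivalent if their difference is an integer linear combination of the vectors $\Delta^{(c)}$, $c\in V$. A configuration is effective if it is toppling equivalent to a configuration with all values $\ge 0$ (non-negative). The rank is $\mathrm{rank}(u)=-1+\min\{\mathrm{degree}(f):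 f \text{ non-negative and } u-f \text{ not effective}\}$. A proof for the rank of $u$ is a non-negative configuration $f$ such that $u-f$ is not effective and $\mathrm{degree}(f)=\mathrm{rank}(u)+1$. A configuration $u$ is parking (with respect to the sink $a_m$) if $u_c\ge 0$ for every $c\neq a_m$ and, for every non-empty $C\subseteq V\setminus\{a_m\}$, the configuration $u-\Delta^{(C)}$ takes a negative value at some vertex other than $a_m$. Every configuration $u$ is toppling equivalent to exactly one parking configuration, denoted $\mathrm{park}(u)$; and $u$ is effective if and only if $\mathrm{park}(u)$ is non-negative (i.e. its value at the sink is $\ge 0$). -}

module Defs where

open import Data.Bool.Base using (Bool; true; false; if_then_else_)
open import Data.Fin.Base using (Fin; fromℕ)
import Data.Fin.Properties as Fin
open import Data.Integer.Base using (ℤ; +_; 0ℤ; 1ℤ; -1ℤ; _+_; _-_; _*_; _≤_; _<_)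
open import Data.Integer.Properties using (+-0-commutativeMonoid)
open import Data.Nat.Base using (ℕ; zero; suc; NonZero)
open import Data.Product.Base using (Σ-syntax; ∃-syntax; _×_)
open import Data.Sum.Base using (_⊎_; inj₁; inj₂)
open import Data.Sum.Properties using (≡-dec)
open import Relation.Binary.Definitions using (DecidableEquality)
open import Relation.Binary.PropositionalEquality using (_≡_; _≢_)
open import Relation.Nullary using (¬_; does)
open import Algebra.Properties.CommutativeMonoid.Sum +-0-commutativeMonoid using (sum)

private
  variable
    m n : ℕ

-- Vertices of K_{m,n}.

V : ℕ → ℕ → Set
V m n = Fin m ⊎ Fin n

pattern a i = inj₁ i
pattern b j = inj₂ j

_≟ⱽ_ : DecidableEquality (V m n)
_≟ⱽ_ = ≡-dec Fin._≟_ Fin._≟_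

adjacent : V m n → V m n → Bool
adjacent (a _) (a _) = false
adjacent (a _) (b _) = true
adjacent (b _) (a _) = true
adjacent (b _) (b _) = false

vertexDegree : V m n → ℕ
vertexDegree {m} {n} (a _) = n
vertexDegree {m} {n} (b _) = m

-- a_m: indices run from 0 here, so this is the last element of Fin m.
sink : .{{NonZero m}} → V m n
sink {suc m} = a (fromℕ m)

sumⱽ : (V m n → ℤ) → ℤ
sumⱽ g = sum (λ i → g (a i)) + sum (λ j → g (b j))

Config : ℕ → ℕ → Set
Config m n = V m n → ℤ

infixl 6 _+ᶜ_ _-ᶜ_

_+ᶜ_ _-ᶜ_ : Config m n → Config m n → Config m n
(u +ᶜ w) c = u c + w c
(u -ᶜ w) c = u c - w c

0ᶜ : Config m n
0ᶜ _ = 0ℤ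

degree : Config m n → ℤ
degree = sumⱽ

e : V m n → Config m n
e c x = if does (c ≟ⱽ x) then 1ℤ else 0ℤ

NonNegative : Config m n → Set
NonNegative u = ∀ c → 0ℤ ≤ u c

Δ : V m n → Config m n
Δ c x = + vertexDegree c * e c x
      - sumⱽ (λ c′ → if adjacent c c′ then e c′ x else 0ℤ)

-- Sets of vertices are given by their Boolean characteristic functions.
Δ-set : (V m n → Bool) → Config m n
Δ-set C x = sumⱽ (λ c → if C c then Δ c x else 0ℤ)

_∼_ : Config m n → Config m n → Set
_∼_ {m} {n} u w =
  Σ[ k ∈ (V m n → ℤ) ] (∀ x → (u -ᶜ w) x ≡ sumⱽ (λ c → k c * Δ c x))

Effective : Config m n → Set
Effective {m} {n} u = Σ[ w ∈ Config m n ] (u ∼ w × NonNegative w)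

IsMinimum : (ℤ → Set) → ℤ → Set
IsMinimum P d = P d × (∀ d′ → P d′ → d ≤ d′)

-- IsRank u r reads "rank(u) = r".  The minimum determines r uniquely; that it
-- is attained is part of what has to be shown in order to assert IsRank u r.
IsRank : Config m n → ℤ → Set
IsRank {m} {n} u r = ∃[ d ] (IsMinimum AttainedDegree d × r ≡ -1ℤ + d)
  where
  AttainedDegree : ℤ → Set
  AttainedDegree d =
    Σ[ f ∈ Config m n ] (NonNegative f × ¬ Effective (u -ᶜ f) × degree f ≡ d)

IsRankProof : Config m n → Config m n → Set
IsRankProof u f =
  NonNegative f × ¬ Effective (u -ᶜ f) × (∃[ r ] (IsRank u r × degree f ≡ r + 1ℤ))

module _ .{{_ : NonZero m}} where

  IsParking : Config m n → Set
  IsParking {n} u =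
      (∀ c → c ≢ sink → 0ℤ ≤ u c)
    × ((C : V m n → Bool) → C sink ≡ false → ∃[ c ] (C c ≡ true) →
       ∃[ c ] (c ≢ sink × (u -ᶜ Δ-set C) c < 0ℤ))

  -- IsPark u v reads "v = park(u)".  Since configurations are functions, v is
  -- determined by u up to pointwise equality.
  IsPark : Config m n → Config m n → Set
  IsPark u v = IsParking v × u ∼ v

  -- Run u k v f: some sequence of choices leads, after k iterations of the
  -- procedure started from u, to v_k = v and f_k = f.
  data Run (u : Config m n) : ℕ → Config m n → Config m n → Set where
    start : ∀ {v} → IsPark u v → Run u 0 v 0ᶜ
    step  : ∀ {k v f v′} → Run u k v f → 0ℤ ≤ v sink →
            ∀ i → v (b i) ≡ 0ℤ → IsPark (v -ᶜ e (b i)) v′ →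
            Run u (suc k) v′ (f +ᶜ e (b i))

{-# OPTIONS --safe #-}
module Submission where

-- Let v be parking and non-negative with v(b_i) = 0, and let f ≥ 0 make v - f not effective.
-- It suffices to find such an f of the same degree with f(b_i) > 0: then v - e_{b_i} has rank
-- one less than v, and induction along the run gives N ≤ degree f for all such f.
-- A chip of f at a_r can be moved to B: park v - f + e_{a_r} with respect to a_r.  The result is
-- ≤ 0 at a_r and vanishes at some b_j, and removing a chip at b_j makes it not effective.
-- Repeat this until v - f is negative at some b_j; this happens at the latest when f vanishes
-- on A, since v - f is not effective and v ≥ 0.  Exchanging the values of v - f at b_i and b_j
-- is a symmetry of the graph, and the new f is positive at b_i.

open import Defs
open import Data.Bool.Base using (Bool; true; false; not; if_then_else_)
import Data.Bool.Properties as Bool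
open import Data.Fin.Base using (Fin; zero; suc; fromℕ)
open import Data.Fin.Permutation as Perm using (Permutation; _⟨$⟩ʳ_; transpose)
import Data.Fin.Properties as Fin
open import Data.Fin.Subset using (Subset)
open import Data.Fin.Subset.Properties using (anySubset?)
open import Data.Integer.Base using (ℤ; +_; -_; 0ℤ; 1ℤ; -1ℤ; _+_; _-_; _*_; _≤_; _<_; ∣_∣)
import Data.Integer.Base as ℤ
open import Data.Integer.Properties
open import Algebra.Properties.CommutativeMonoid.Sum +-0-commutativeMonoid
open import Data.Integer.Tactic.RingSolver using (solve-∀)
open import Data.Nat.Base as ℕ using (ℕ; NonZero)
open import Data.Product.Base using (∃-syntax; _×_; _,_; proj₁; proj₂)
open import Data.Sum.Base using (_⊎_; inj₁; inj₂)
open import Data.Vec.Base using (lookup; tabulate)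
open import Data.Vec.Properties using (lookup∘tabulate)
open import Function.Base using (_∘_)
open import Relation.Binary.PropositionalEquality
  using (_≡_; _≢_; refl; sym; trans; cong; cong₂; subst; module ≡-Reasoning)
open import Relation.Nullary using (¬_; Dec; yes; no; does)
open import Relation.Nullary.Decidable using (_×-dec_; ¬?; dec-true; dec-false)
open import Relation.Nullary.Negation using (contradiction)

private
  variable
    m n : ℕ

-- Integer arithmetic and finite sums

≤-via : ∀ {d} i j → j - i ≡ d → 0ℤ ≤ d → i ≤ j
≤-via i j refl = 0≤i-j⇒j≤i

<⇒1≤- : ∀ {i j} → i < j → 1ℤ ≤ j - i
<⇒1≤- {i} {j} i<j = ≤-via 1ℤ (j - i) (eq i j) (i≤j⇒0≤j-i (i<j⇒suc[i]≤j i<j))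
  where
  eq : ∀ i j → (j - i) - 1ℤ ≡ j - (1ℤ + i)
  eq = solve-∀

p-[p-q] : ∀ p q → p - (p - q) ≡ q
p-[p-q] = solve-∀

interchange-sub : ∀ p q r s → (p - q) + (r - s) ≡ (p + r) - (q + s)
interchange-sub = solve-∀

interchange-add : ∀ p q r s → (p + q) + (r + s) ≡ (p + r) + (q + s)
interchange-add = solve-∀

sub-interchange : ∀ p q r s → (p - q) - (r - s) ≡ (p - r) - (q - s)
sub-interchange = solve-∀

sum-zero : ∀ n → sum {n} (λ _ → 0ℤ) ≡ 0ℤ
sum-zero = sum-replicate-zero

sum-mono : {f g : Fin n → ℤ} → (∀ i → f i ≤ g i) → sum f ≤ sum g
sum-mono {ℕ.zero}  f≤g = ≤-refl
sum-mono {ℕ.suc n} f≤g = +-mono-≤ (f≤g zero) (sum-mono (f≤g ∘ suc))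

sum-nonneg : {f : Fin n → ℤ} → (∀ i → 0ℤ ≤ f i) → 0ℤ ≤ sum f
sum-nonneg {n} {f} 0≤f = subst (_≤ sum f) (sum-zero n) (sum-mono 0≤f)

term≤sum : {f : Fin n → ℤ} → (∀ i → 0ℤ ≤ f i) → ∀ i → f i ≤ sum f
term≤sum {ℕ.suc n} {f} 0≤f zero =
  subst (_≤ sum f) (+-identityʳ (f zero)) (+-monoʳ-≤ (f zero) (sum-nonneg (0≤f ∘ suc)))
term≤sum {ℕ.suc n} {f} 0≤f (suc i) =
  subst (_≤ sum f) (+-identityˡ (f (suc i))) (+-mono-≤ (0≤f zero) (term≤sum (0≤f ∘ suc) i))

sum-*ˡ : ∀ c (f : Fin n → ℤ) → sum (λ i → c * f i) ≡ c * sum f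
sum-*ˡ {ℕ.zero}  c f = sym (*-zeroʳ c)
sum-*ˡ {ℕ.suc n} c f = trans (cong (_+_ (c * f zero)) (sum-*ˡ c (f ∘ suc)))
  (sym (*-distribˡ-+ c (f zero) (sum (f ∘ suc))))

sum-sub : (f g : Fin n → ℤ) → sum (λ i → f i - g i) ≡ sum f - sum g
sum-sub {ℕ.zero}  f g = refl
sum-sub {ℕ.suc n} f g = trans (cong (_+_ (f zero - g zero)) (sum-sub (f ∘ suc) (g ∘ suc)))
  (interchange-sub (f zero) (g zero) (sum (f ∘ suc)) (sum (g ∘ suc)))

sum-const : ∀ n c → sum {n} (λ _ → c) ≡ + n * c
sum-const ℕ.zero    c = refl
sum-const (ℕ.suc n) c = trans (cong (_+_ c) (sum-const n c)) (sym (suc-* (+ n) c))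

sum-const-sub : ∀ c (f : Fin n → ℤ) → sum (λ i → c - f i) ≡ + n * c - sum f
sum-const-sub {n} c f = trans (sum-sub (λ _ → c) f) (cong (_- sum f) (sum-const n c))

-- Between two vertices on the same side, `e` computes to this function, so the lemmas on `δ` apply
-- to `e` and `Δ` without conversion.
δ : Fin n → Fin n → ℤ
δ i j = if does (i Fin.≟ j) then 1ℤ else 0ℤ

δ-sym : (i j : Fin n) → δ i j ≡ δ j i
δ-sym zero    zero    = refl
δ-sym zero    (suc j) = refl
δ-sym (suc i) zero    = refl
δ-sym (suc i) (suc j) = δ-sym i j

sum-δ : (g : Fin n → ℤ) (x : Fin n) → sum (λ i → g i * δ i x) ≡ g x
sum-δ {ℕ.suc n} g zero = trans
  (cong₂ _+_ (*-identityʳ (g zero))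
    (trans (sum-cong-≗ {n} λ i → *-zeroʳ (g (suc i))) (sum-zero n)))
  (+-identityʳ (g zero))
sum-δ {ℕ.suc n} g (suc x) = trans
  (cong₂ _+_ (*-zeroʳ (g zero)) (sum-δ (g ∘ suc) x)) (+-identityˡ (g (suc x)))

sum-δˡ : (x : Fin n) → sum (λ i → δ i x) ≡ 1ℤ
sum-δˡ {n} x = trans (sum-cong-≗ {n} λ i → sym (*-identityˡ (δ i x))) (sum-δ (λ _ → 1ℤ) x)

sum-δʳ : (x : Fin n) → sum (δ x) ≡ 1ℤ
sum-δʳ {n} x = trans (sum-cong-≗ {n} (δ-sym x)) (sum-δˡ x)

sumⱽ-cong : {f g : V m n → ℤ} → (∀ x → f x ≡ g x) → sumⱽ f ≡ sumⱽ g
sumⱽ-cong {m} {n} f≗g = cong₂ _+_ (sum-cong-≗ {m} (f≗g ∘ inj₁)) (sum-cong-≗ {n} (f≗g ∘ inj₂))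

sumⱽ-sub : (f g : V m n → ℤ) → sumⱽ (λ x → f x - g x) ≡ sumⱽ f - sumⱽ g
sumⱽ-sub f g = trans (cong₂ _+_ (sum-sub (f ∘ inj₁) (g ∘ inj₁)) (sum-sub (f ∘ inj₂) (g ∘ inj₂)))
  (interchange-sub (sum (f ∘ inj₁)) (sum (g ∘ inj₁)) (sum (f ∘ inj₂)) (sum (g ∘ inj₂)))

sumⱽ-add : (f g : V m n → ℤ) → sumⱽ (λ x → f x + g x) ≡ sumⱽ f + sumⱽ g
sumⱽ-add f g = trans
  (cong₂ _+_ (∑-distrib-+ (f ∘ inj₁) (g ∘ inj₁)) (∑-distrib-+ (f ∘ inj₂) (g ∘ inj₂)))
  (interchange-add (sum (f ∘ inj₁)) (sum (g ∘ inj₁)) (sum (f ∘ inj₂)) (sum (g ∘ inj₂)))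

sumⱽ-zero : ∀ m n → sumⱽ {m} {n} (λ _ → 0ℤ) ≡ 0ℤ
sumⱽ-zero m n = cong₂ _+_ (sum-zero m) (sum-zero n)

sumⱽ-nonneg : {f : V m n → ℤ} → (∀ x → 0ℤ ≤ f x) → 0ℤ ≤ sumⱽ f
sumⱽ-nonneg 0≤f = +-mono-≤ (sum-nonneg (0≤f ∘ inj₁)) (sum-nonneg (0≤f ∘ inj₂))

term≤sumⱽ : {f : V m n → ℤ} → (∀ x → 0ℤ ≤ f x) → ∀ x → f x ≤ sumⱽ f
term≤sumⱽ {f = f} 0≤f (a i) = subst (_≤ sumⱽ f) (+-identityʳ (f (a i)))
  (+-mono-≤ (term≤sum (0≤f ∘ inj₁) i) (sum-nonneg (0≤f ∘ inj₂)))
term≤sumⱽ {f = f} 0≤f (b j) = subst (_≤ sumⱽ f) (+-identityˡ (f (b j)))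
  (+-mono-≤ (sum-nonneg (0≤f ∘ inj₁)) (term≤sum (0≤f ∘ inj₂) j))

-- The Laplacian

-- The graph Laplacian, written as a sum of differences along edges rather than as a combination of
-- toppling vectors: comparison and vanishing on constants are then termwise.
lap : (V m n → ℤ) → Config m n
lap k (a i) = sum (λ j → k (a i) - k (b j))
lap k (b j) = sum (λ i → k (b j) - k (a i))

Δ-aa : (i i′ : Fin m) → Δ {m} {n} (a i) (a i′) ≡ + n * δ i i′
Δ-aa {m} {n} i i′ = trans (cong₂ (λ s t → + n * δ i i′ - (s + t)) (sum-zero m) (sum-zero n))
  (+-identityʳ (+ n * δ i i′))

Δ-ab : (i : Fin m) (j : Fin n) → Δ (a i) (b j) ≡ -1ℤ
Δ-ab {m} {n} i j = trans (cong₂ (λ s t → + n * 0ℤ - (s + t)) (sum-zero m) (sum-δˡ j))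
  (cong (_+ -1ℤ) (*-zeroʳ (+ n)))

Δ-ba : (j : Fin n) (i : Fin m) → Δ (b j) (a i) ≡ -1ℤ
Δ-ba {n} {m} j i = trans (cong₂ (λ s t → + m * 0ℤ - (s + t)) (sum-δˡ i) (sum-zero n))
  (cong (_+ -1ℤ) (*-zeroʳ (+ m)))

Δ-bb : (j j′ : Fin n) → Δ {m} {n} (b j) (b j′) ≡ + m * δ j j′
Δ-bb {n} {m} j j′ = trans (cong₂ (λ s t → + m * δ j j′ - (s + t)) (sum-zero m) (sum-zero n))
  (+-identityʳ (+ m * δ j j′))

sum-*δ : ∀ c (k : Fin n → ℤ) x → sum (λ i → k i * (c * δ i x)) ≡ c * k x
sum-*δ {n} c k x = trans (sum-cong-≗ {n} λ i → eq (k i) c (δ i x))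
  (trans (sum-*ˡ c (λ i → k i * δ i x)) (cong (c *_) (sum-δ k x)))
  where
  eq : ∀ k c d → k * (c * d) ≡ c * (k * d)
  eq = solve-∀

sum-*-1 : (k : Fin n → ℤ) → sum (λ i → k i * -1ℤ) ≡ -1ℤ * sum k
sum-*-1 {n} k = trans (sum-cong-≗ {n} λ i → *-comm (k i) -1ℤ) (sum-*ˡ -1ℤ k)

sum-Δ : (k : V m n → ℤ) (x : V m n) → sumⱽ (λ c → k c * Δ c x) ≡ lap k x
sum-Δ {m} {n} k (a i) = begin
  sumⱽ (λ c → k c * Δ c (a i))
    ≡⟨ cong₂ _+_
         (trans (sum-cong-≗ {m} λ i′ → cong (k (a i′) *_) (Δ-aa {n = n} i′ i))
                (sum-*δ (+ n) (k ∘ inj₁) i))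
         (trans (sum-cong-≗ {n} λ j → cong (k (b j) *_) (Δ-ba j i)) (sum-*-1 (k ∘ inj₂))) ⟩
  + n * k (a i) + -1ℤ * sum (k ∘ inj₂)  ≡⟨ eq (+ n * k (a i)) (sum (k ∘ inj₂)) ⟩
  + n * k (a i) - sum (k ∘ inj₂)        ≡⟨ sum-const-sub (k (a i)) (k ∘ inj₂) ⟨
  lap k (a i)                           ∎
  where
  open ≡-Reasoning
  eq : ∀ s t → s + -1ℤ * t ≡ s - t
  eq = solve-∀
sum-Δ {m} {n} k (b j) = begin
  sumⱽ (λ c → k c * Δ c (b j))
    ≡⟨ cong₂ _+_
         (trans (sum-cong-≗ {m} λ i → cong (k (a i) *_) (Δ-ab i j)) (sum-*-1 (k ∘ inj₁)))
         (trans (sum-cong-≗ {n} λ j′ → cong (k (b j′) *_) (Δ-bb {m = m} j′ j))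
                (sum-*δ (+ m) (k ∘ inj₂) j)) ⟩
  -1ℤ * sum (k ∘ inj₁) + + m * k (b j)  ≡⟨ eq (+ m * k (b j)) (sum (k ∘ inj₁)) ⟩
  + m * k (b j) - sum (k ∘ inj₁)        ≡⟨ sum-const-sub (k (b j)) (k ∘ inj₁) ⟨
  lap k (b j)                           ∎
  where
  open ≡-Reasoning
  eq : ∀ s t → -1ℤ * t + s ≡ s - t
  eq = solve-∀

indicator : (V m n → Bool) → V m n → ℤ
indicator C x = if C x then 1ℤ else 0ℤ

Δ-set-lap : (C : V m n → Bool) (x : V m n) → Δ-set C x ≡ lap (indicator C) x
Δ-set-lap C x = trans (sumⱽ-cong term) (sum-Δ (indicator C) x)
  where
  term : ∀ c → (if C c then Δ c x else 0ℤ) ≡ indicator C c * Δ c x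
  term c with C c
  ... | true  = sym (*-identityˡ (Δ c x))
  ... | false = refl

Δ-set-cong : {C D : V m n → Bool} → (∀ x → C x ≡ D x) → ∀ x → Δ-set C x ≡ Δ-set D x
Δ-set-cong C≗D x = sumⱽ-cong λ c → cong (if_then Δ c x else 0ℤ) (C≗D c)

-- The Laplacian at `x` sums only differences taken from `x`. Comparison with a constant function
-- then gives the discrete maximum principle in the next lemmas.
lap-mono : {k l : V m n → ℤ} (x : V m n) → (∀ y → k x - k y ≤ l x - l y) → lap k x ≤ lap l x
lap-mono (a i) k≤l = sum-mono (k≤l ∘ inj₂)
lap-mono (b j) k≤l = sum-mono (k≤l ∘ inj₁)

lap-const : ∀ c (x : V m n) → lap (λ _ → c) x ≡ 0ℤ
lap-const {m} {n} c (a i) = trans (sum-cong-≗ {n} λ _ → +-inverseʳ c) (sum-zero n)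
lap-const {m} {n} c (b j) = trans (sum-cong-≗ {m} λ _ → +-inverseʳ c) (sum-zero m)

lap-nonneg : {k : V m n → ℤ} (x : V m n) → (∀ y → k y ≤ k x) → 0ℤ ≤ lap k x
lap-nonneg {k = k} x k≤ =
  subst (_≤ lap k x) (lap-const 0ℤ x) (lap-mono x λ y → i≤j⇒0≤j-i (k≤ y))

lap-nonpos : {k : V m n → ℤ} (x : V m n) → (∀ y → k x ≤ k y) → lap k x ≤ 0ℤ
lap-nonpos {k = k} x k≤ =
  subst (lap k x ≤_) (lap-const 0ℤ x) (lap-mono x λ y → i≤j⇒i-j≤0 (k≤ y))

lap-sub : (k l : V m n → ℤ) (x : V m n) → lap (λ y → k y - l y) x ≡ lap k x - lap l x
lap-sub {m} {n} k l (a i) = trans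
  (sum-cong-≗ {n} λ j → sub-interchange (k (a i)) (l (a i)) (k (b j)) (l (b j)))
  (sum-sub (λ j → k (a i) - k (b j)) (λ j → l (a i) - l (b j)))
lap-sub {m} {n} k l (b j) = trans
  (sum-cong-≗ {m} λ i → sub-interchange (k (b j)) (l (b j)) (k (a i)) (l (a i)))
  (sum-sub (λ i → k (b j) - k (a i)) (λ i → l (b j) - l (a i)))

lap-*ˡ : ∀ c (k : V m n → ℤ) (x : V m n) → lap (λ y → c * k y) x ≡ c * lap k x
lap-*ˡ {m} {n} c k = go
  where
  eq : ∀ c p q → c * p - c * q ≡ c * (p - q)
  eq = solve-∀
  go : ∀ x → lap (λ y → c * k y) x ≡ c * lap k x
  go (a i) = trans (sum-cong-≗ {n} λ j → eq c (k (a i)) (k (b j))) (sum-*ˡ {n} c _)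
  go (b j) = trans (sum-cong-≗ {m} λ i → eq c (k (b j)) (k (a i))) (sum-*ˡ {m} c _)

-- Both sides equal the Dirichlet form, the sum over all edges of the product of the differences of
-- `φ` and `k`, which is symmetric in the two functions.
lap-selfAdjoint : (φ k : V m n → ℤ) →
  sumⱽ (λ x → φ x * lap k x) ≡ sumⱽ (λ x → k x * lap φ x)
lap-selfAdjoint {m} {n} φ k = trans (dirichlet φ k) (trans
  (sum-cong-≗ {m} λ i → sum-cong-≗ {n} λ j → *-comm (φ (a i) - φ (b j)) (k (a i) - k (b j)))
  (sym (dirichlet k φ)))
  where
  open ≡-Reasoning
  eq : ∀ p q r s → p * (r - s) + q * (s - r) ≡ (p - q) * (r - s)
  eq = solve-∀
  dirichlet : ∀ φ k → sumⱽ (λ x → φ x * lap k x) ≡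
    sum {m} (λ i → sum {n} λ j → (φ (a i) - φ (b j)) * (k (a i) - k (b j)))
  dirichlet φ k = begin
    sum (λ i → φ (a i) * lap k (a i)) + sum (λ j → φ (b j) * lap k (b j))
      ≡⟨ cong₂ _+_
           (sum-cong-≗ {m} λ i → sym (sum-*ˡ {n} (φ (a i)) λ j → k (a i) - k (b j)))
           (trans (sum-cong-≗ {n} λ j → sym (sum-*ˡ {m} (φ (b j)) λ i → k (b j) - k (a i)))
                  (∑-comm {n} {m} λ j i → φ (b j) * (k (b j) - k (a i)))) ⟩
    sum A→B + sum B→A
      ≡⟨ ∑-distrib-+ {m} A→B B→A ⟨
    sum (λ i → A→B i + B→A i)
      ≡⟨ sum-cong-≗ {m} (λ i → trans (sym (∑-distrib-+ {n} _ _))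
           (sum-cong-≗ {n} λ j → eq (φ (a i)) (φ (b j)) (k (a i)) (k (b j)))) ⟩
    sum (λ i → sum λ j → (φ (a i) - φ (b j)) * (k (a i) - k (b j))) ∎
    where
    A→B B→A : Fin m → ℤ
    A→B i = sum {n} λ j → φ (a i) * (k (a i) - k (b j))
    B→A i = sum {n} λ j → φ (b j) * (k (b j) - k (a i))

-- Toppling equivalence

infix 4 _≈_

-- This is `_∼_` with the toppling vectors collected into `lap`. As a record it keeps `u` and `w`
-- visible to inference.
record _≈_ (u w : Config m n) : Set where
  constructor firing
  field
    count : V m n → ℤ
    diff  : ∀ x → u x - w x ≡ lap count x

-- Effective with the non-negative configuration eliminated; as a record, it lets u be inferred.
record Winnable (u : Config m n) : Set where
  constructor winning
  field
    strategy : V m n → ℤ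
    lap≤     : ∀ x → lap strategy x ≤ u x

≈⇒∼ : {u w : Config m n} → u ≈ w → u ∼ w
≈⇒∼ (firing k eq) = k , λ x → trans (eq x) (sym (sum-Δ k x))

∼⇒≈ : {u w : Config m n} → u ∼ w → u ≈ w
∼⇒≈ (k , eq) = firing k λ x → trans (eq x) (sum-Δ k x)

Effective⇒Winnable : {u : Config m n} → Effective u → Winnable u
Effective⇒Winnable {u = u} (w , (k , eq) , 0≤w) = winning k λ x →
  ≤-via (lap k x) (u x)
    (trans (cong (_-_ (u x)) (trans (sym (sum-Δ k x)) (sym (eq x)))) (p-[p-q] (u x) (w x))) (0≤w x)

Winnable⇒Effective : {u : Config m n} → Winnable u → Effective u
Winnable⇒Effective {u = u} (winning k lap≤u) =
  (λ x → u x - lap k x) , ≈⇒∼ {u = u} (firing k λ x → p-[p-q] (u x) (lap k x)) ,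
  λ x → i≤j⇒0≤j-i (lap≤u x)

nonneg⇒Winnable : {u : Config m n} → NonNegative u → Winnable u
nonneg⇒Winnable {u = u} 0≤u =
  winning (λ _ → 0ℤ) λ x → subst (_≤ u x) (sym (lap-const 0ℤ x)) (0≤u x)

≈-refl : {u : Config m n} → u ≈ u
≈-refl {u = u} = firing (λ _ → 0ℤ) λ x → trans (+-inverseʳ (u x)) (sym (lap-const 0ℤ x))

≈-sym : {u w : Config m n} → u ≈ w → w ≈ u
≈-sym {u = u} {w} (firing k eq) = firing (λ x → 0ℤ - k x) λ x → begin
    w x - u x                     ≡⟨ flip (w x) (u x) ⟩
    0ℤ - (u x - w x)              ≡⟨ cong₂ _-_ (sym (lap-const 0ℤ x)) (eq x) ⟩
    lap (λ _ → 0ℤ) x - lap k x    ≡⟨ lap-sub (λ _ → 0ℤ) k x ⟨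
    lap (λ y → 0ℤ - k y) x        ∎
  where
  open ≡-Reasoning
  flip : ∀ p q → p - q ≡ 0ℤ - (q - p)
  flip = solve-∀

≈-trans : {u w z : Config m n} → u ≈ w → w ≈ z → u ≈ z
≈-trans {u = u} {w} {z} (firing k eq) w≈z with firing l eq′ ← ≈-sym w≈z =
  firing (λ x → k x - l x) λ x → begin
    u x - z x                  ≡⟨ split (u x) (w x) (z x) ⟩
    (u x - w x) - (z x - w x)  ≡⟨ cong₂ _-_ (eq x) (eq′ x) ⟩
    lap k x - lap l x          ≡⟨ lap-sub k l x ⟨
    lap (λ y → k y - l y) x    ∎
  where
  open ≡-Reasoning
  split : ∀ p q r → p - r ≡ (p - q) - (r - q)
  split = solve-∀

-- The firing vector depends only on the difference of the two configurations, so later equivalences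
-- reduce to ring identities.
≈-translate : {u w u′ w′ : Config m n} → u ≈ w → (∀ x → u′ x - w′ x ≡ u x - w x) → u′ ≈ w′
≈-translate (firing k eq) same = firing k λ x → trans (same x) (eq x)

≈-sub : {u w : Config m n} → u ≈ w → (f : Config m n) → u -ᶜ f ≈ w -ᶜ f
≈-sub {u = u} {w} u≈w f = ≈-translate u≈w λ x → eq (u x) (w x) (f x)
  where
  eq : ∀ p q r → (p - r) - (q - r) ≡ p - q
  eq = solve-∀

Winnable-≈ : {u w : Config m n} → u ≈ w → Winnable w → Winnable u
Winnable-≈ u≈w win with z , w∼z , 0≤z ← Winnable⇒Effective win =
  Effective⇒Winnable (z , ≈⇒∼ (≈-trans u≈w (∼⇒≈ w∼z)) , 0≤z)

-- The degree pairs a configuration with the constant 1. By self-adjointness the Laplacian moves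
-- onto this constant, where it vanishes.
degree-≈ : {u w : Config m n} → u ≈ w → degree u ≡ degree w
degree-≈ {m} {n} {u} {w} (firing k eq) = i-j≡0⇒i≡j (degree u) (degree w) (begin
  degree u - degree w                    ≡⟨ sumⱽ-sub u w ⟨
  sumⱽ (λ x → u x - w x)                 ≡⟨ sumⱽ-cong eq ⟩
  sumⱽ (lap k)                           ≡⟨ sumⱽ-cong (λ x → *-identityˡ (lap k x)) ⟨
  sumⱽ (λ x → 1ℤ * lap k x)              ≡⟨ lap-selfAdjoint (λ _ → 1ℤ) k ⟩
  sumⱽ (λ x → k x * lap (λ _ → 1ℤ) x)
    ≡⟨ sumⱽ-cong (λ x → trans (cong (k x *_) (lap-const 1ℤ x)) (*-zeroʳ (k x))) ⟩
  sumⱽ {m} {n} (λ _ → 0ℤ)                ≡⟨ sumⱽ-zero m n ⟩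
  0ℤ                                     ∎)
  where open ≡-Reasoning

-- Parking configurations

δ-refl : (i : Fin n) → δ i i ≡ 1ℤ
δ-refl i = cong (if_then 1ℤ else 0ℤ) (dec-true (i Fin.≟ i) refl)

δ-≢ : {i j : Fin n} → i ≢ j → δ i j ≡ 0ℤ
δ-≢ {i = i} {j} i≢j = cong (if_then 1ℤ else 0ℤ) (dec-false (i Fin.≟ j) i≢j)

0≤e : (c x : V m n) → 0ℤ ≤ e c x
0≤e c x with does (c ≟ⱽ x)
... | true  = ℤ.+≤+ ℕ.z≤n
... | false = ≤-refl

anyⱽ? : {P : V m n → Set} → (∀ x → Dec (P x)) → Dec (∃[ x ] P x)
anyⱽ? P? with Fin.any? (P? ∘ inj₁) | Fin.any? (P? ∘ inj₂)
... | yes (i , p) | _           = yes (a i , p)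
... | no _        | yes (j , p) = yes (b j , p)
... | no ¬pa      | no ¬pb      = no λ { (a i , p) → ¬pa (i , p) ; (b j , p) → ¬pb (j , p) }

Blocked : V m n → Config m n → (V m n → Bool) → Set
Blocked q u C = ∃[ c ] (c ≢ q × (u -ᶜ Δ-set C) c < 0ℤ)

-- IsParking u unfolds to ParkingAt sink u.
ParkingAt : V m n → Config m n → Set
ParkingAt q u =
    (∀ c → c ≢ q → 0ℤ ≤ u c)
  × (∀ C → C q ≡ false → ∃[ c ] (C c ≡ true) → Blocked q u C)

-- The search starts from the vertex `q`, so an empty family causes no trouble, and the searches
-- over the two sides can be chained.
argmax-from : ∀ {p} (k : V m n → ℤ) (f : Fin p → V m n) (q : V m n) →
  ∃[ x ] (k q ≤ k x × (∀ i → k (f i) ≤ k x))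
argmax-from {p = ℕ.zero}  k f q = q , ≤-refl , λ ()
argmax-from {p = ℕ.suc p} k f q
  with x , q≤x , f≤x ← argmax-from k (f ∘ suc) q
  with ≤-total (k (f zero)) (k x)
... | inj₁ f₀≤x = x , q≤x , λ { zero → f₀≤x ; (suc i) → f≤x i }
... | inj₂ x≤f₀ = f zero , ≤-trans q≤x x≤f₀ ,
                  λ { zero → ≤-refl ; (suc i) → ≤-trans (f≤x i) x≤f₀ }

argmax : (k : V m n → ℤ) (q : V m n) → ∃[ x ] (∀ y → k y ≤ k x)
argmax k q
  with x , _ , A≤x ← argmax-from k inj₁ q
  with y , x≤y , B≤y ← argmax-from k inj₂ x
  = y , λ { (a i) → ≤-trans (A≤x i) x≤y ; (b j) → B≤y j }

-- If k were larger elsewhere than at q, the set where k is maximal could be fired.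
parking-max : {q : V m n} {v : Config m n} → ParkingAt q v →
  (k : V m n → ℤ) → (∀ x → lap k x ≤ v x) → ∀ x → k x ≤ k q
parking-max {m} {n} {q} {v} (0≤v , blocked) k lap≤v y
  with x₀ , ≤x₀ ← argmax k q
  with k x₀ ≤? k q
... | yes x₀≤q = ≤-trans (≤x₀ y) x₀≤q
... | no  x₀≰q = contradiction v-Δ<0 (≤⇒≯ (i≤j⇒0≤j-i (Δ≤v c c≢q)))
  where
  -- Since `k x₀` is the maximum, this is the set where `k` attains it.
  C : V m n → Bool
  C x = does (k x₀ ≤? k x)

  unfireable : Blocked q v C
  unfireable = blocked C (dec-false (k x₀ ≤? k q) x₀≰q)
                         (x₀ , dec-true (k x₀ ≤? k x₀) ≤-refl)
  c = proj₁ unfireable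
  c≢q = proj₁ (proj₂ unfireable)
  v-Δ<0 = proj₂ (proj₂ unfireable)

  -- Integrality enters here: outside `C` the value of `k` is at least 1 below its maximum, so at
  -- vertices of `C` firing `C` costs no more than firing `k`.
  ind-≤ : ∀ x → k x₀ ≤ k x → ∀ y → indicator C x - indicator C y ≤ k x - k y
  ind-≤ x x₀≤x y
    rewrite dec-true (k x₀ ≤? k x) x₀≤x with k x₀ ≤? k y
  ... | yes _    = i≤j⇒0≤j-i (≤-trans (≤x₀ y) x₀≤x)
  ... | no  x₀≰y = <⇒1≤- (<-≤-trans (≰⇒> x₀≰y) x₀≤x)

  Δ≤v : ∀ x → x ≢ q → Δ-set C x ≤ v x
  Δ≤v x x≢q rewrite Δ-set-lap C x with k x₀ ≤? k x
  ... | yes x₀≤x = ≤-trans (lap-mono x (ind-≤ x x₀≤x)) (lap≤v x)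
  -- Outside `C` firing `C` can only add chips, and `v` is non-negative there because `x` is not the
  -- sink.
  ... | no  x₀≰x = ≤-trans (lap-nonpos x ind-min) (0≤v x x≢q)
    where
    ind-min : ∀ y → indicator C x ≤ indicator C y
    ind-min y rewrite dec-false (k x₀ ≤? k x) x₀≰x with does (k x₀ ≤? k y)
    ... | true  = ℤ.+≤+ ℕ.z≤n
    ... | false = ≤-refl

-- A strategy would be maximal at `q`, hence have non-negative Laplacian there, although it is
-- bounded by the negative `v q`.
parking-neg⇒¬Winnable : {q : V m n} {v : Config m n} →
  ParkingAt q v → v q < 0ℤ → ¬ Winnable v
parking-neg⇒¬Winnable {q = q} parking v<0 win
  with winning k lap≤v ← win
  = contradiction v<0 (≤⇒≯ (≤-trans (lap-nonneg q (parking-max parking k lap≤v)) (lap≤v q)))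

-- A firing vector making v - e_{b_j} non-negative would be maximal at a_r,
-- hence constant on B, hence maximal at b_j, where no chip can be spared.
parking-zero⇒¬Winnable : {r : Fin m} {v : Config m n} → ParkingAt (a r) v → v (a r) ≤ 0ℤ →
  ∀ j → v (b j) ≡ 0ℤ → ¬ Winnable (v -ᶜ e (b j))
parking-zero⇒¬Winnable {r = r} {v} parking v≤0 j vj≡0 win
  with winning k lap≤ ← win
  = contradiction (≤-trans (lap-nonneg (b j) b-max) (lap≤ (b j))) λ 0≤ →
      contradiction (subst (0ℤ ≤_) (cong₂ _-_ vj≡0 (δ-refl j)) 0≤) λ ()
  where
  lap≤v : ∀ x → lap k x ≤ v x
  lap≤v x = ≤-trans (lap≤ x)
    (≤-via (v x - e (b j) x) (v x) (p-[p-q] (v x) (e (b j) x)) (0≤e (b j) x))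
  r-max : ∀ x → k x ≤ k (a r)
  r-max = parking-max parking k lap≤v
  b-max : ∀ x → k x ≤ k (b j)
  -- The differences `k (a r) - k (b i)` are non-negative and their sum `lap k (a r)` is at most 0,
  -- so each of them is at most 0.
  b-max x = ≤-trans (r-max x) (i-j≤0⇒i≤j (≤-trans
    (term≤sum (λ i → i≤j⇒0≤j-i (r-max (b i))) j) (≤-trans (lap≤v (a r)) v≤0)))

-- Firing everything but the sink takes one chip from each b_j and none from A.
parking-zero : {r : Fin m} {v : Config m (ℕ.suc n)} → ParkingAt (a r) v → ∃[ j ] v (b j) ≡ 0ℤ
parking-zero {m} {n} {r} {v} (0≤v , blocked) = zero-at (blocked C C-sink (b zero , refl))
  where
  C : V m (ℕ.suc n) → Bool
  C (a i) = not (does (i Fin.≟ r))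
  C (b j) = true

  C-sink : C (a r) ≡ false
  C-sink = cong not (dec-true (r Fin.≟ r) refl)

  1-ind : ∀ i → 1ℤ - indicator C (a i) ≡ δ i r
  1-ind i with does (i Fin.≟ r)
  ... | true  = refl
  ... | false = refl

  Δ-a : ∀ i → i ≢ r → Δ-set C (a i) ≡ 0ℤ
  Δ-a i i≢r = trans (Δ-set-lap C (a i)) (trans (sum-cong-≗ {ℕ.suc n} λ _ →
    cong (λ c → (if not c then 1ℤ else 0ℤ) - 1ℤ) (dec-false (i Fin.≟ r) i≢r))
    (sum-zero (ℕ.suc n)))

  Δ-b : ∀ j → Δ-set C (b j) ≡ 1ℤ
  Δ-b j = trans (Δ-set-lap C (b j)) (trans (sum-cong-≗ {m} 1-ind) (sum-δˡ r))

  zero-at : Blocked (a r) v C → ∃[ j ] v (b j) ≡ 0ℤ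
  zero-at (a i , i≢r , neg) = contradiction neg
    (≤⇒≯ (i≤j⇒0≤j-i (subst (_≤ v (a i)) (sym (Δ-a i (i≢r ∘ cong inj₁))) (0≤v (a i) i≢r))))
  zero-at (b j , j≢ , neg) = j , ≤-antisym (i<j⇒i≤pred[j] v<1) (0≤v (b j) j≢)
    where
    v<1 : v (b j) < 1ℤ
    v<1 = ≰⇒> λ 1≤v → ≤⇒≯ (i≤j⇒0≤j-i 1≤v) (subst (λ d → v (b j) - d < 0ℤ) (Δ-b j) neg)

-- Existence of parking configurations

module Stabilisation {m n : ℕ} (r : Fin m) where

  q : V m (ℕ.suc n)
  q = a r

  -- A function vanishing at the sink whose Laplacian is positive elsewhere: firing
  -- a set avoiding the sink decreases the weighted number of chips.
  φ : V m (ℕ.suc n) → ℤ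
  φ (a i) = (+ m + 1ℤ) * (1ℤ - δ i r)
  φ (b j) = + m

  φ-q : φ q ≡ 0ℤ
  φ-q = trans (cong (λ d → (+ m + 1ℤ) * (1ℤ - d)) (δ-refl r)) (*-zeroʳ (+ m + 1ℤ))

  φ-a : ∀ {i} → i ≢ r → φ (a i) ≡ + m + 1ℤ
  φ-a i≢r = trans (cong (λ d → (+ m + 1ℤ) * (1ℤ - d)) (δ-≢ i≢r)) (*-identityʳ (+ m + 1ℤ))

  0≤φ : ∀ x → 0ℤ ≤ φ x
  0≤φ (a i) = subst (_≤ φ (a i)) (*-zeroʳ (+ m + 1ℤ))
    (*-monoˡ-≤-nonNeg (+ m + 1ℤ) (i≤j⇒0≤j-i (δ≤1 i)))
    where
    δ≤1 : ∀ i → δ i r ≤ 1ℤ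
    δ≤1 i with does (i Fin.≟ r)
    ... | true  = ≤-refl
    ... | false = ℤ.+≤+ ℕ.z≤n
  0≤φ (b j) = ℤ.+≤+ ℕ.z≤n

  -- The constants in `φ` are chosen for this. At `a i` every neighbour contributes 1. At `b j` the
  -- sink contributes `m` and each of the other `m - 1` neighbours contributes -1, leaving exactly
  -- 1.
  1≤lap-φ : ∀ x → x ≢ q → 1ℤ ≤ lap φ x
  1≤lap-φ (a i) i≢q = subst (1ℤ ≤_) (sym (begin
    lap φ (a i)
      ≡⟨ sum-cong-≗ {ℕ.suc n} (λ _ → trans (cong (_- + m) (φ-a (i≢q ∘ cong inj₁))) (eq (+ m))) ⟩
    sum {ℕ.suc n} (λ _ → 1ℤ)  ≡⟨ sum-const (ℕ.suc n) 1ℤ ⟩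
    + ℕ.suc n * 1ℤ            ≡⟨ *-identityʳ (+ ℕ.suc n) ⟩
    + ℕ.suc n                 ∎)) (ℤ.+≤+ (ℕ.s≤s ℕ.z≤n))
    where
    open ≡-Reasoning
    eq : ∀ p → (p + 1ℤ) - p ≡ 1ℤ
    eq = solve-∀
  1≤lap-φ (b j) _ = ≤-reflexive (sym (begin
    lap φ (b j)
      ≡⟨ sum-cong-≗ {m} (λ i → eq (+ m) (δ i r)) ⟩
    sum (λ i → (+ m + 1ℤ) * δ i r - 1ℤ)
      ≡⟨ sum-sub {m} (λ i → (+ m + 1ℤ) * δ i r) (λ _ → 1ℤ) ⟩
    sum (λ i → (+ m + 1ℤ) * δ i r) - sum {m} (λ _ → 1ℤ)
      ≡⟨ cong₂ _-_ (sum-δ (λ _ → + m + 1ℤ) r) (sum-const m 1ℤ) ⟩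
    (+ m + 1ℤ) - + m * 1ℤ
      ≡⟨ eq′ (+ m) ⟩
    1ℤ ∎))
    where
    open ≡-Reasoning
    eq : ∀ p d → p - (p + 1ℤ) * (1ℤ - d) ≡ (p + 1ℤ) * d - 1ℤ
    eq = solve-∀
    eq′ : ∀ p → (p + 1ℤ) - p * 1ℤ ≡ 1ℤ
    eq′ = solve-∀

  weight : Config m (ℕ.suc n) → ℤ
  weight u = sumⱽ (λ x → φ x * u x)

  NonNegOff : Config m (ℕ.suc n) → Set
  NonNegOff u = ∀ x → x ≢ q → 0ℤ ≤ u x

  0≤weight : ∀ u → NonNegOff u → 0ℤ ≤ weight u
  0≤weight u 0≤u = sumⱽ-nonneg term
    where
    term : ∀ x → 0ℤ ≤ φ x * u x
    term x with x ≟ⱽ q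
    -- The sink may be in debt, but `φ` gives it weight 0.
    ... | yes x≡q = ≤-reflexive (sym (trans (cong (λ y → φ y * u x) x≡q) (cong (_* u x) φ-q)))
    ... | no  x≢q = subst (_≤ φ x * u x) (*-zeroʳ (φ x))
      (*-monoˡ-≤-nonNeg (φ x) {{ℤ.nonNegative (0≤φ x)}} (0≤u x x≢q))

  -- By self-adjointness this weight is the sum of `lap φ` over `C`. Every term is at least 1
  -- because `C` avoids the sink, and `c` supplies one term.
  1≤weight-Δ-set : ∀ C → C q ≡ false → ∃[ c ] (C c ≡ true) → 1ℤ ≤ weight (Δ-set C)
  1≤weight-Δ-set C q∉C (c , c∈C) = begin
    1ℤ                                    ≤⟨ 1≤lap-φ c c≢q ⟩
    lap φ c                               ≡⟨ *-identityˡ (lap φ c) ⟨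
    1ℤ * lap φ c                          ≡⟨ cong (λ p → (if p then 1ℤ else 0ℤ) * lap φ c) c∈C ⟨
    indicator C c * lap φ c               ≤⟨ term≤sumⱽ 0≤term c ⟩
    sumⱽ (λ x → indicator C x * lap φ x)  ≡⟨ lap-selfAdjoint φ (indicator C) ⟨
    sumⱽ (λ x → φ x * lap (indicator C) x)
      ≡⟨ sumⱽ-cong (λ x → cong (φ x *_) (sym (Δ-set-lap C x))) ⟩
    weight (Δ-set C)                      ∎
    where
    open ≤-Reasoning
    c≢q : c ≢ q
    c≢q refl = contradiction (trans (sym c∈C) q∉C) λ ()
    0≤term : ∀ x → 0ℤ ≤ indicator C x * lap φ x
    0≤term x with C x in Cx
    ... | false = ≤-refl
    ... | true  = subst (0ℤ ≤_) (sym (*-identityˡ (lap φ x)))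
      (≤-trans (ℤ.+≤+ ℕ.z≤n) (1≤lap-φ x λ { refl → contradiction (trans (sym Cx) q∉C) λ () }))

  weight-sub : ∀ u w → weight (u -ᶜ w) ≡ weight u - weight w
  weight-sub u w = trans (sumⱽ-cong λ x → eq (φ x) (u x) (w x))
    (sumⱽ-sub (λ x → φ x * u x) (λ x → φ x * w x))
    where
    eq : ∀ p q r → p * (q - r) ≡ p * q - p * r
    eq = solve-∀

  Fireable : Config m (ℕ.suc n) → (V m (ℕ.suc n) → Bool) → Set
  Fireable u C = C q ≡ false × (∃[ c ] (C c ≡ true)) × ¬ Blocked q u C

  blocked? : ∀ u C → Dec (Blocked q u C)
  blocked? u C = anyⱽ? λ c → ¬? (c ≟ⱽ q) ×-dec ((u -ᶜ Δ-set C) c <? 0ℤ)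

  fireable? : ∀ u C → Dec (Fireable u C)
  fireable? u C = (C q Bool.≟ false) ×-dec (anyⱽ? (λ c → C c Bool.≟ true) ×-dec ¬? (blocked? u C))

  Blocked-resp : ∀ {u C D} → (∀ x → C x ≡ D x) → Blocked q u C → Blocked q u D
  Blocked-resp {u} C≗D (c , c≢q , neg) =
    c , c≢q , subst (λ d → u c - d < 0ℤ) (Δ-set-cong C≗D c) neg

  fromSubsets : Subset m → Subset (ℕ.suc n) → V m (ℕ.suc n) → Bool
  fromSubsets S T (a i) = lookup S i
  fromSubsets S T (b j) = lookup T j

  -- Pairs of subsets of the two sides can be searched exhaustively. Every Boolean function agrees
  -- pointwise with such a pair, and being blocked respects pointwise equality.
  parking-or-fireable : ∀ u → NonNegOff u → ParkingAt q u ⊎ ∃[ C ] Fireable u C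
  parking-or-fireable u 0≤u
    with anySubset? (λ S → anySubset? λ T → fireable? u (fromSubsets S T))
  ... | yes (S , T , fire) = inj₂ (fromSubsets S T , fire)
  ... | no  none           = inj₁ (0≤u , blocked)
    where
    blocked : ∀ C → C q ≡ false → ∃[ c ] (C c ≡ true) → Blocked q u C
    blocked C q∉C (c , c∈C) with blocked? u C
    ... | yes bl = bl
    ... | no ¬bl = contradiction
      (S , T , trans (same q) q∉C , (c , trans (same c) c∈C) , ¬bl ∘ Blocked-resp {u} same) none
      where
      S = tabulate (C ∘ inj₁)
      T = tabulate (C ∘ inj₂)
      same : ∀ x → fromSubsets S T x ≡ C x
      same (a i) = lookup∘tabulate (C ∘ inj₁) i
      same (b j) = lookup∘tabulate (C ∘ inj₂) j

  -- Induction on a strict bound for the weight. Firing a fireable set keeps the values off the sink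
  -- non-negative and lowers the weight by at least 1, while the weight can never be negative.
  stabilise : ∀ K u → NonNegOff u → weight u < + K → ∃[ v ] (ParkingAt q v × u ≈ v)
  stabilise ℕ.zero    u 0≤u small = contradiction small (≤⇒≯ (0≤weight u 0≤u))
  stabilise (ℕ.suc K) u 0≤u small with parking-or-fireable u 0≤u
  ... | inj₁ parking = u , parking , ≈-refl
  ... | inj₂ (C , q∉C , c∈C , ¬bl) =
    let v , parking , u′≈v = stabilise K u′ 0≤u′ (<-≤-trans lighter (i<j⇒i≤pred[j] small))
    in  v , parking , ≈-trans u≈u′ u′≈v
    where
    u′ = u -ᶜ Δ-set C
    0≤u′ : NonNegOff u′
    0≤u′ x x≢q = ≮⇒≥ λ neg → ¬bl (x , x≢q , neg)
    u≈u′ : u ≈ u′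
    u≈u′ = firing (indicator C) λ x → trans (p-[p-q] (u x) (Δ-set C x)) (Δ-set-lap C x)
    lighter : weight u′ < weight u
    lighter = suc[i]≤j⇒i<j (≤-via (1ℤ + weight u′) (weight u)
      (trans (cong (λ t → weight u - (1ℤ + t)) (weight-sub u (Δ-set C)))
             (eq (weight u) (weight (Δ-set C))))
      (i≤j⇒0≤j-i (1≤weight-Δ-set C q∉C c∈C)))
      where
      eq : ∀ p q → p - (1ℤ + (p - q)) ≡ q - 1ℤ
      eq = solve-∀

  -- Adding `K * lap φ` gives every vertex off the sink at least `K` chips, and `K`, the sum of all
  -- absolute values, covers every debt.
  lift-off-sink : ∀ u → ∃[ v ] (NonNegOff v × u ≈ v)
  lift-off-sink u = v , 0≤v , ≈-sym (firing (λ x → K * φ x) λ x →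
    trans (eq (u x) (K * lap φ x)) (sym (lap-*ˡ K φ x)))
    where
    K = sumⱽ (λ x → + ∣ u x ∣)
    v : Config m (ℕ.suc n)
    v x = u x + K * lap φ x
    eq : ∀ p q → (p + q) - p ≡ q
    eq = solve-∀
    0≤K : 0ℤ ≤ K
    0≤K = sumⱽ-nonneg {f = λ x → + ∣ u x ∣} λ x → ℤ.+≤+ ℕ.z≤n
    0≤i+∣i∣ : ∀ i → 0ℤ ≤ i + + ∣ i ∣
    0≤i+∣i∣ (+ p)        = ℤ.+≤+ ℕ.z≤n
    0≤i+∣i∣ (ℤ.-[1+ p ]) = ≤-reflexive (sym (+-inverseʳ ℤ.-[1+ p ]))
    0≤v : NonNegOff v
    0≤v x x≢q = ≤-trans (0≤i+∣i∣ (u x)) (+-monoʳ-≤ (u x) (begin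
      + ∣ u x ∣    ≤⟨ term≤sumⱽ {f = λ x → + ∣ u x ∣} (λ _ → ℤ.+≤+ ℕ.z≤n) x ⟩
      K            ≡⟨ *-identityʳ K ⟨
      K * 1ℤ       ≤⟨ *-monoˡ-≤-nonNeg K {{ℤ.nonNegative 0≤K}} (1≤lap-φ x x≢q) ⟩
      K * lap φ x  ∎))
      where open ≤-Reasoning

  park : ∀ u → ∃[ v ] (ParkingAt q v × u ≈ v)
  park u with v , 0≤v , u≈v ← lift-off-sink u
    with w , parking , v≈w ← stabilise (ℕ.suc ∣ weight v ∣) v 0≤v
           (i≤pred[j]⇒i<j (≤-reflexive (sym (0≤i⇒+∣i∣≡i (0≤weight v 0≤v)))))
    = w , parking , ≈-trans u≈v v≈w

open Stabilisation using (park)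

-- Moving chips onto a given b_i

e-refl : (c : V m n) → e c c ≡ 1ℤ
e-refl c = cong (if_then 1ℤ else 0ℤ) (dec-true (c ≟ⱽ c) refl)

e-≢ : {c x : V m n} → c ≢ x → e c x ≡ 0ℤ
e-≢ {c = c} {x} c≢x = cong (if_then 1ℤ else 0ℤ) (dec-false (c ≟ⱽ x) c≢x)

degree-e : (c : V m n) → degree (e c) ≡ 1ℤ
degree-e {m} {n} (a i) = cong₂ _+_ (sum-δʳ i) (sum-zero n)
degree-e {m} {n} (b j) = cong₂ _+_ (sum-zero m) (sum-δʳ j)

remove-chip : {u : Config m n} (c : V m n) → (∀ x → x ≢ c → 0ℤ ≤ u x) → 0ℤ < u c →
  NonNegative (u -ᶜ e c)
remove-chip {u = u} c 0≤u 0<u x with x ≟ⱽ c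
... | yes refl = i≤j⇒0≤j-i (subst (_≤ u x) (sym (e-refl x)) (i<j⇒suc[i]≤j 0<u))
... | no  x≢c  = i≤j⇒0≤j-i (subst (_≤ u x) (sym (e-≢ (x≢c ∘ sym))) (0≤u x x≢c))

-- Parking with respect to a_r leaves no chip at a_r, and some b_j empty, which can serve instead.
exchange : (u h : Config m (ℕ.suc n)) (r : Fin m) → ¬ Winnable (u -ᶜ h) →
  ∃[ j ] ¬ Winnable (u -ᶜ (h -ᶜ e (a r) +ᶜ e (b j)))
exchange {m} {n} u h r ¬win = j , λ win →
  parking-zero⇒¬Winnable parking v≤0 j vj≡0 (Winnable-≈ (≈-sym u-h′≈v-e) win)
  where
  -- The chip that `h` takes at `a r` is given back before parking.
  parked = park r (u -ᶜ (h -ᶜ e (a r)))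
  v = proj₁ parked
  parking = proj₁ (proj₂ parked)
  w≈v = proj₂ (proj₂ parked)
  zero-at = parking-zero parking
  j = proj₁ zero-at
  vj≡0 = proj₂ zero-at

  u-h≈v-e : u -ᶜ h ≈ v -ᶜ e (a r)
  u-h≈v-e = ≈-translate w≈v λ x → eq (u x) (h x) (v x) (e (a r) x)
    where
    eq : ∀ p q s t → (p - q) - (s - t) ≡ (p - (q - t)) - s
    eq = solve-∀

  u-h′≈v-e : u -ᶜ (h -ᶜ e (a r) +ᶜ e (b j)) ≈ v -ᶜ e (b j)
  u-h′≈v-e = ≈-translate w≈v λ x → eq (u x) (h x) (v x) (e (a r) x) (e (b j) x)
    where
    eq : ∀ p q s t t′ → (p - ((q - t) + t′)) - (s - t′) ≡ (p - (q - t)) - s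
    eq = solve-∀

  v≤0 : v (a r) ≤ 0ℤ
  -- If `v` had a chip at `a r`, taking it would leave a non-negative configuration equivalent to
  -- `u -ᶜ h`.
  v≤0 = ≮⇒≥ λ 0<v →
    ¬win (Winnable-≈ u-h≈v-e (nonneg⇒Winnable (remove-chip (a r) (proj₁ parking) 0<v)))

-- Some value of `u -ᶜ h` is negative, as otherwise it would be winnable. If this happens at `a r`,
-- then `h` has a chip there, which `exchange` moves to `B`; the bound `s` on the chips of `h` on
-- `A` drops by 1 each time.
exhaust-A : ∀ s (u h : Config m (ℕ.suc n)) → NonNegative u → NonNegative h →
  sum (h ∘ inj₁) ≤ + s → ¬ Winnable (u -ᶜ h) →
  ∃[ h′ ] (NonNegative h′ × degree h′ ≡ degree h × ¬ Winnable (u -ᶜ h′) ×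
           ∃[ j ] (u -ᶜ h′) (b j) < 0ℤ)
exhaust-A {m} {n} s u h 0≤u 0≤h small ¬win with anyⱽ? (λ x → (u -ᶜ h) x <? 0ℤ)
... | no  none        = contradiction (nonneg⇒Winnable λ x → ≮⇒≥ λ neg → none (x , neg)) ¬win
... | yes (b j , neg) = h , 0≤h , refl , ¬win , j , neg
... | yes (a r , neg) = move s small
  where
  0<h : 0ℤ < h (a r)
  0<h = ≰⇒> λ h≤0 → ≤⇒≯ (i≤j⇒0≤j-i (≤-trans h≤0 (0≤u (a r)))) neg

  exchanged = exchange u h r ¬win
  j = proj₁ exchanged
  h′ = h -ᶜ e (a r) +ᶜ e (b j)

  0≤h′ : NonNegative h′
  0≤h′ x = +-mono-≤ (remove-chip {u = h} (a r) (λ x _ → 0≤h x) 0<h x) (0≤e (b j) x)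

  degree-h′ : degree h′ ≡ degree h
  degree-h′ = begin
    degree h′
      ≡⟨ sumⱽ-add (h -ᶜ e (a r)) (e (b j)) ⟩
    degree (h -ᶜ e (a r)) + degree (e {m} (b j))
      ≡⟨ cong₂ _+_ (sumⱽ-sub h (e (a r))) (degree-e {m} (b j)) ⟩
    degree h - degree (e {m} {ℕ.suc n} (a r)) + 1ℤ
      ≡⟨ cong (λ d → degree h - d + 1ℤ) (degree-e {n = ℕ.suc n} (a r)) ⟩
    degree h - 1ℤ + 1ℤ
      ≡⟨ eq (degree h) ⟩
    degree h ∎
    where
    open ≡-Reasoning
    eq : ∀ p → p - 1ℤ + 1ℤ ≡ p
    eq = solve-∀

  sum-h′ : sum (h′ ∘ inj₁) ≡ sum (h ∘ inj₁) - 1ℤ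
  sum-h′ = trans (sum-cong-≗ {m} λ i → +-identityʳ (h (a i) - δ r i))
    (trans (sum-sub (h ∘ inj₁) (δ r)) (cong (_-_ (sum (h ∘ inj₁))) (sum-δʳ r)))

  move : ∀ s → sum (h ∘ inj₁) ≤ + s →
    ∃[ h′ ] (NonNegative h′ × degree h′ ≡ degree h × ¬ Winnable (u -ᶜ h′) ×
             ∃[ j ] (u -ᶜ h′) (b j) < 0ℤ)
  -- The bound leaves no chip on `A`, yet `h` has one at `a r`.
  move ℕ.zero small = contradiction 0<h (≤⇒≯ (≤-trans (term≤sum (0≤h ∘ inj₁) r) small))
  move (ℕ.suc s) small =
    let h″ , 0≤h″ , deg , rest = exhaust-A s u h′ 0≤u 0≤h′ smaller (proj₂ exchanged)
    in  h″ , 0≤h″ , trans deg degree-h′ , rest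
    where
    smaller : sum (h′ ∘ inj₁) ≤ + s
    smaller = subst (_≤ + s) (sym sum-h′) (+-monoˡ-≤ -1ℤ small)

-- Graph automorphisms permuting B

permuteB : Permutation n n → V m n → V m n
permuteB π (a i) = a i
permuteB π (b j) = b (π ⟨$⟩ʳ j)

-- At a vertex of `A` the permutation only reorders the sum over `B`; at a vertex of `B` both sides
-- agree by computation.
lap-permuteB : (π : Permutation n n) (k : V m n → ℤ) (x : V m n) →
  lap (k ∘ permuteB π) x ≡ lap k (permuteB π x)
lap-permuteB π k (a i) = sym (sum-permute (λ j → k (a i) - k (b j)) π)
lap-permuteB π k (b j) = refl

Winnable-permuteB : (π : Permutation n n) {u : Config m n} →
  Winnable (u ∘ permuteB π) → Winnable u
Winnable-permuteB π {u} (winning k lap≤) = winning (k ∘ permuteB (Perm.flip π)) λ x → begin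
    lap (k ∘ permuteB (Perm.flip π)) x     ≡⟨ lap-permuteB (Perm.flip π) k x ⟩
    lap k (permuteB (Perm.flip π) x)       ≤⟨ lap≤ (permuteB (Perm.flip π) x) ⟩
    u (permuteB π (permuteB (Perm.flip π) x)) ≡⟨ cong u (inverse x) ⟩
    u x                                    ∎
  where
  open ≤-Reasoning
  inverse : ∀ x → permuteB π (permuteB (Perm.flip π) x) ≡ x
  inverse (a i) = refl
  inverse (b j) = cong inj₂ (Perm.inverseʳ π)

degree-permuteB : (π : Permutation n n) (u : Config m n) → degree (u ∘ permuteB π) ≡ degree u
degree-permuteB π u = cong (_+_ (sum (u ∘ inj₁))) (sym (sum-permute (u ∘ inj₂) π))

transpose-matchˡ : (i j : Fin n) → transpose i j ⟨$⟩ʳ i ≡ j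
transpose-matchˡ i j rewrite dec-true (i Fin.≟ i) refl = refl

transpose-matchʳ : (i j : Fin n) → transpose i j ⟨$⟩ʳ j ≡ i
transpose-matchʳ i j with j Fin.≟ i
... | yes j≡i = j≡i
... | no  _ rewrite dec-true (j Fin.≟ j) refl = refl

transpose-mismatch : {i j l : Fin n} → l ≢ i → l ≢ j → transpose i j ⟨$⟩ʳ l ≡ l
transpose-mismatch {i = i} {j} {l} l≢i l≢j
  rewrite dec-false (l Fin.≟ i) l≢i | dec-false (l Fin.≟ j) l≢j = refl

-- Exchanging the values of u - h at b_i and b_j is a symmetry of the graph.
transfer : (u h : Config m n) → NonNegative u → NonNegative h → ¬ Winnable (u -ᶜ h) →
  ∀ i → u (b i) ≡ 0ℤ → ∀ j → (u -ᶜ h) (b j) < 0ℤ →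
  ∃[ h′ ] (NonNegative h′ × degree h′ ≡ degree h × ¬ Winnable (u -ᶜ h′) × 0ℤ < h′ (b i))
transfer {m} {n} u h 0≤u 0≤h ¬win i ui≡0 j neg = h′ , 0≤h′ , degree-h′ , ¬win′ , 0<h′i
  where
  π = transpose i j
  D = u -ᶜ h
  -- Chosen so that `u -ᶜ h′` is `D` with two values exchanged. It equals `- D (b j)` at `b i`,
  -- `u (b j) + h (b i)` at `b j` because `u (b i)` is 0, and `h` elsewhere.
  h′ = u -ᶜ D ∘ permuteB π

  0<h′i : 0ℤ < h′ (b i)
  0<h′i = subst (0ℤ <_)
    (sym (trans (cong₂ (λ p l → p - D (b l)) ui≡0 (transpose-matchˡ i j))
      (+-identityˡ (- D (b j)))))
    (neg-mono-< neg)

  0≤h′j : 0ℤ ≤ h′ (b j)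
  0≤h′j = subst (0ℤ ≤_)
    (sym (trans (cong (λ l → u (b j) - D (b l)) (transpose-matchʳ i j))
         (trans (cong (λ p → u (b j) - (p - h (b i))) ui≡0) (eq (u (b j)) (h (b i))))))
    (+-mono-≤ (0≤u (b j)) (0≤h (b i)))
    where
    eq : ∀ p q → p - (0ℤ - q) ≡ p + q
    eq = solve-∀

  0≤h′ : NonNegative h′
  0≤h′ (a r) = subst (0ℤ ≤_) (sym (p-[p-q] (u (a r)) (h (a r)))) (0≤h (a r))
  0≤h′ (b l) = at-b (l Fin.≟ i) (l Fin.≟ j)
    where
    at-b : Dec (l ≡ i) → Dec (l ≡ j) → 0ℤ ≤ h′ (b l)
    at-b (yes l≡i) _         = subst (λ l → 0ℤ ≤ h′ (b l)) (sym l≡i) (<⇒≤ 0<h′i)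
    at-b (no _)    (yes l≡j) = subst (λ l → 0ℤ ≤ h′ (b l)) (sym l≡j) 0≤h′j
    at-b (no l≢i)  (no l≢j)  = subst (0ℤ ≤_)
      (sym (trans (cong (λ l′ → u (b l) - D (b l′)) (transpose-mismatch l≢i l≢j))
                  (p-[p-q] (u (b l)) (h (b l))))) (0≤h (b l))

  degree-h′ : degree h′ ≡ degree h
  degree-h′ = begin
    degree h′                               ≡⟨ sumⱽ-sub u (D ∘ permuteB π) ⟩
    degree u - degree (D ∘ permuteB π)      ≡⟨ cong (_-_ (degree u)) (trans (degree-permuteB π D) (sumⱽ-sub u h)) ⟩
    degree u - (degree u - degree h)        ≡⟨ p-[p-q] (degree u) (degree h) ⟩
    degree h                                ∎
    where open ≡-Reasoning

  ¬win′ : ¬ Winnable (u -ᶜ h′)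
  ¬win′ (winning k lap≤) = ¬win (Winnable-permuteB π (winning k λ x →
    subst (lap k x ≤_) (p-[p-q] (u x) (D (permuteB π x))) (lap≤ x)))

-- This is what makes the choice of the index immaterial: a witness can be given a chip at any
-- prescribed empty `b i` without changing its degree.
charge : (u h : Config m (ℕ.suc n)) → NonNegative u → NonNegative h → ¬ Winnable (u -ᶜ h) →
  ∀ i → u (b i) ≡ 0ℤ →
  ∃[ h′ ] (NonNegative h′ × degree h′ ≡ degree h × ¬ Winnable (u -ᶜ h′) × 0ℤ < h′ (b i))
charge u h 0≤u 0≤h ¬win i ui≡0 =
  let h₁ , 0≤h₁ , deg₁ , ¬win₁ , j , neg =
        exhaust-A ∣ sum (h ∘ inj₁) ∣ u h 0≤u 0≤h
          (≤-reflexive (sym (0≤i⇒+∣i∣≡i (sum-nonneg (0≤h ∘ inj₁))))) ¬win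
      h₂ , 0≤h₂ , deg₂ , ¬win₂ , 0<h₂ = transfer u h₁ 0≤u 0≤h₁ ¬win₁ i ui≡0 j neg
  in  h₂ , 0≤h₂ , trans deg₂ deg₁ , ¬win₂ , 0<h₂

-- Runs of the procedure

module _ {m n : ℕ} {u : Config (ℕ.suc m) (ℕ.suc n)} where

  run-parking : ∀ {k v f} → Run u k v f → ParkingAt sink v
  run-parking (start (parking , _))          = parking
  run-parking (step _ _ _ _ (parking , _)) = parking

  run-≈ : ∀ {k v f} → Run u k v f → u -ᶜ f ≈ v
  run-≈ (start {v} (_ , u∼v)) = ≈-translate (∼⇒≈ {u = u} {v} u∼v) λ x → cong (_- v x) (+-identityʳ (u x))
  run-≈ (step {v = v} {f} run _ i _ (_ , v-e∼v′)) =
    ≈-trans (≈-translate (run-≈ run) λ x → eq (u x) (f x) (v x) (e (b i) x)) (∼⇒≈ v-e∼v′)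
    where
    eq : ∀ p q r s → (p - (q + s)) - (r - s) ≡ (p - q) - r
    eq = solve-∀

  run-nonneg : ∀ {k v f} → Run u k v f → NonNegative f
  run-nonneg (start _)          x = ≤-refl
  run-nonneg (step run _ i _ _) x = +-mono-≤ (run-nonneg run x) (0≤e (b i) x)

  run-degree : ∀ {k v f} → Run u k v f → degree f ≡ + k
  run-degree (start _) = sumⱽ-zero (ℕ.suc m) (ℕ.suc n)
  run-degree (step {k} {f = f} run _ i _ _) = begin
    degree (f +ᶜ e (b i))
      ≡⟨ sumⱽ-add f (e (b i)) ⟩
    degree f + degree (e {ℕ.suc m} (b i))
      ≡⟨ cong₂ _+_ (run-degree run) (degree-e {ℕ.suc m} (b i)) ⟩
    + k + 1ℤ
      ≡⟨ +-comm (+ k) 1ℤ ⟩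
    + ℕ.suc k ∎
    where open ≡-Reasoning

  parking-nonneg : {v : Config (ℕ.suc m) (ℕ.suc n)} →
    ParkingAt sink v → 0ℤ ≤ v sink → NonNegative v
  parking-nonneg {v} (0≤v , _) 0≤v-sink x with x ≟ⱽ sink
  ... | yes x≡sink = subst (λ x → 0ℤ ≤ v x) (sym x≡sink) 0≤v-sink
  ... | no  x≢sink = 0≤v x x≢sink

  -- The degree of the current configuration is `degree u - + k`. A step is taken only from a
  -- non-negative configuration, so `k` is at most `degree u` before the step and at most one more
  -- after it.
  run-bound : ∀ {k v f} → Run u k v f → k ℕ.≤ ℕ.suc ∣ degree u ∣
  run-bound (start _) = ℕ.z≤n
  run-bound (step {k} {v} {f} run 0≤v-sink _ _ _) = ℕ.s≤s (drop‿+≤+ (begin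
    + k             ≤⟨ k≤deg ⟩
    degree u        ≡⟨ 0≤i⇒+∣i∣≡i (≤-trans (ℤ.+≤+ ℕ.z≤n) k≤deg) ⟨
    + ∣ degree u ∣  ∎))
    where
    open ≤-Reasoning
    degree-v : degree u - + k ≡ degree v
    degree-v = trans (cong (_-_ (degree u)) (sym (run-degree run)))
      (trans (sym (sumⱽ-sub u f)) (degree-≈ (run-≈ run)))
    k≤deg : + k ≤ degree u
    k≤deg = ≤-via (+ k) (degree u) degree-v
      (sumⱽ-nonneg (parking-nonneg (run-parking run) 0≤v-sink))

  -- Any witness that u has small rank can be made to follow the choices of the run.
  run-lower : ∀ {k v f} → Run u k v f → ∀ g → NonNegative g → ¬ Winnable (u -ᶜ g) →
    ∃[ h ] (NonNegative h × + k + degree h ≡ degree g × ¬ Winnable (v -ᶜ h))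
  run-lower (start {v} (_ , u∼v)) g 0≤g ¬win =
    g , 0≤g , +-identityˡ (degree g) , ¬win ∘ Winnable-≈ (≈-sub (∼⇒≈ {u = u} {v} u∼v) g)
  run-lower (step {k} {v} {v′ = v′} run 0≤v-sink i vi≡0 (_ , v-e∼v′)) g 0≤g ¬win =
    let h , 0≤h , deg , ¬win-h = run-lower run g 0≤g ¬win
        h′ , 0≤h′ , deg′ , ¬win-h′ , 0<h′i =
          charge v h (parking-nonneg (run-parking run) 0≤v-sink) 0≤h ¬win-h i vi≡0
    -- The chip of `h′` at `b i` is the one this step removes, so it passes from the witness to the
    -- counter `k`.
    in  h′ -ᶜ e (b i) , remove-chip (b i) (λ x _ → 0≤h′ x) 0<h′i ,
        trans (degree-step h′) (trans (cong (_+_ (+ k)) deg′) deg) ,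
        ¬win-h′ ∘ Winnable-≈ (v-h′≈ h′)
    where
    v-h′≈ : ∀ h′ → v -ᶜ h′ ≈ v′ -ᶜ (h′ -ᶜ e (b i))
    v-h′≈ h′ = ≈-translate (∼⇒≈ {u = v -ᶜ e (b i)} {v′} v-e∼v′) λ x → eq (v x) (h′ x) (v′ x) (e (b i) x)
      where
      eq : ∀ p q r s → (p - q) - (r - (q - s)) ≡ (p - s) - r
      eq = solve-∀
    degree-step : ∀ h′ → + ℕ.suc k + degree (h′ -ᶜ e (b i)) ≡ + k + degree h′
    degree-step h′ = begin
      + ℕ.suc k + degree (h′ -ᶜ e (b i))
        ≡⟨ cong (_+_ (+ ℕ.suc k)) (sumⱽ-sub h′ (e (b i))) ⟩
      + ℕ.suc k + (degree h′ - degree (e {ℕ.suc m} (b i)))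
        ≡⟨ cong (λ d → + ℕ.suc k + (degree h′ - d)) (degree-e {ℕ.suc m} (b i)) ⟩
      + ℕ.suc k + (degree h′ - 1ℤ)
        ≡⟨ eq (+ k) (degree h′) ⟩
      + k + degree h′ ∎
      where
      open ≡-Reasoning
      eq : ∀ p q → (1ℤ + p) + (q - 1ℤ) ≡ p + q
      eq = solve-∀

theorem2p1 : (m n : ℕ) → .{{_ : NonZero m}} → .{{_ : NonZero n}} → (u : Config m n) →
  -- the procedure can be started, and no iteration can get stuck
  (∃[ v ] IsPark u v)
  × (∀ k v f → Run u k v f → 0ℤ ≤ v sink →
      (∃[ i ] v (b i) ≡ 0ℤ)
      × (∀ i → v (b i) ≡ 0ℤ → ∃[ v′ ] IsPark (v -ᶜ e (b i)) v′))
  -- it terminates, whatever the choices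
  × (∃[ K ] (∀ k v f → Run u k v f → k ℕ.≤ K))
  -- any final configuration is a proof for the rank
  × (∀ N v f → Run u N v f → v sink < 0ℤ →
      IsRankProof u f
      × IsRank u (+ N - 1ℤ)
      × + N - 1ℤ ≡ degree f - 1ℤ)
theorem2p1 (ℕ.suc m) (ℕ.suc n) u =
    isPark u
  , (λ k v f run _ → parking-zero (run-parking run) , λ i _ → isPark (v -ᶜ e (b i)))
  , (ℕ.suc ∣ degree u ∣ , λ k v f → run-bound)
  , final
  where
  isPark : (u : Config (ℕ.suc m) (ℕ.suc n)) → ∃[ v ] IsPark u v
  isPark u = let v , parking , u≈v = park (fromℕ m) u in v , parking , ≈⇒∼ u≈v

  final : ∀ N v f → Run u N v f → v sink < 0ℤ →
    IsRankProof u f × IsRank u (+ N - 1ℤ) × + N - 1ℤ ≡ degree f - 1ℤ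
  final N v f run v<0 =
      (run-nonneg run , ¬eff , + N - 1ℤ , isRank , trans (run-degree run) (eq (+ N)))
    , isRank , cong (_- 1ℤ) (sym (run-degree run))
    where
    eq : ∀ p → p ≡ p - 1ℤ + 1ℤ
    eq = solve-∀

    ¬eff : ¬ Effective (u -ᶜ f)
    ¬eff eff = parking-neg⇒¬Winnable (run-parking run) v<0
      (Winnable-≈ (≈-sym (run-≈ run)) (Effective⇒Winnable eff))

    minimal : ∀ g → NonNegative g → ¬ Effective (u -ᶜ g) → + N ≤ degree g
    minimal g 0≤g ¬eff-g =
      -- Following the run splits `degree g` into `+ N` and the degree of the non-negative remainder
      -- `h`.
      let h , 0≤h , deg , _ = run-lower run g 0≤g (¬eff-g ∘ Winnable⇒Effective)
      in  subst (+ N ≤_) deg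
            (subst (_≤ + N + degree h) (+-identityʳ (+ N)) (+-monoʳ-≤ (+ N) (sumⱽ-nonneg 0≤h)))

    isRank : IsRank u (+ N - 1ℤ)
    isRank = + N
      , ((f , run-nonneg run , ¬eff , run-degree run)
        , λ { d (g , 0≤g , ¬eff-g , refl) → minimal g 0≤g ¬eff-g })
      , +-comm (+ N) -1ℤ
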